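{- Let $\mathcal{D}_n$ be the set of all Dyck paths of semilength $n$. For $d\in\mathcal{D}_n$, let $w(d)=w(d)_1w(d)_2\cdots w(d)_{|w(d)|}$ be the word of positive integers consisting of the lengths of the maximal consecutive strings of north steps of $d$, listed in the order they occur along $d$, where $|w(d)|$ is the number of such strings. Then for every integer $n\ge 1$, $$\mathrm{pf}_n(312,321)=\sum_{d\in\mathcal{D}_n}\ \prod_{i=1}^{|w(d)|-1}\bigl(w(d)_i+1\bigr),$$ where an empty product equals $1$.
   Context: A Dyck path of semilength $n$ is a lattice path from $(0,0)$ to $(n,n)$ consisting of $n$ north steps $N=(0,1)$ and $n$ east steps $E=(1,0)$ that never goes below the line $y=x$. A parking function of size $n$ is a Dyck path of semilength $n$ whose $n$ north steps are labeled bijectively by $\{1,\dots,n\}$ so that whenever two north steps are consecutive in the path (one immediately following the other), the label of the later one is larger. For a parking function $p$ of size $n$, $\phi(p)$ is the permutation of $\{1,\dots,n\}$ (in one-line notation) obtained by reading the labels of the north steps in the order they occur along the path. A permutation $\pi$ of $\{1,\dots,n\}$ contains a permutation $\rho$ of $\{1,\dots,m\}$ if there are indices $1\le i_1<\cdots<i_m\le n$ such that $\pi_{i_a}\le\pi_{i_b}$ if and only if $\rho_a\le\rho_b$; otherwise $\pi$ avoids $\rho$. For permutations $\rho_1,\dots,\rho_r$, $\mathrm{pf}_n(\rho_1,\dots,\rho_r)$ denotes the number of parking functions $p$ of size $n$ such that $\phi(p)$ avoids each of $\rho_1,\dots,\rho_r$. -}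

module Defs where

open import Data.Fin using (Fin; zero; suc) renaming (_<_ to _<ᶠ_)
open import Data.Fin.Properties using (all?) renaming (_<?_ to _<ᶠ?_; any? to anyFin?)
open import Data.List using (List; []; _∷_; _++_; [_]; length; map; filter; mapMaybe; upTo; inits; cartesianProductWith; lookup)
open import Data.List.Properties using (∷-injective)
open import Data.List.Membership.Propositional using (_∈_)
open import Data.List.Membership.DecPropositional using () renaming (_∈?_ to mem?)
open import Data.List.Membership.Propositional.Properties using (∈-cartesianProductWith⁺; ∈-filter⁺; ∈-filter⁻; ∈-∃++; ∈-map⁺; ∈-map⁻)
open import Data.List.Relation.Unary.All as All using (All; []; _∷_)
open import Data.List.Relation.Unary.Any using (here; there)
open import Data.List.Relation.Unary.AllPairs using ([]; _∷_)
open import Data.List.Relation.Unary.Linked using (Linked; linked?)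
open import Data.List.Relation.Unary.Unique.Propositional using (Unique)
import Data.List.Relation.Unary.Unique.Propositional.Properties as Unique
open import Data.List.Relation.Binary.Permutation.Propositional using (_↭_; ↭-refl; ↭-sym; ↭-trans; prep)
open import Data.List.Relation.Binary.Permutation.Propositional.Properties using (∈-resp-↭; shift; drop-∷; ↭-empty-inv)
open import Data.Maybe using (Maybe; just; nothing)
open import Data.Nat using (ℕ; zero; suc; _+_; _≤_; _<_; _≟_; _≤?_; _<?_)
open import Data.Nat.Properties using (+-suc; suc-injective)
open import Data.Product using (∃; _×_; _,_; proj₁; proj₂; <_,_>; uncurry)
open import Data.Unit using (⊤; tt)
open import Data.Vec.Functional using () renaming ([] to []ᶠ; _∷_ to _∷ᶠ_)
open import Function using (_∘_; _⇔_; mk⇔; Equivalence)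
open import Relation.Binary using (DecidableEquality)
open import Relation.Binary.PropositionalEquality using (_≡_; _≢_; _≗_; refl; sym; trans; cong; cong₂; subst; subst₂)
open import Relation.Nullary using (Dec; yes; no; ¬_; ¬?)
open import Relation.Nullary.Decidable using (map′; _×-dec_; _→-dec_)

[1…_] : ℕ → List ℕ
[1… n ] = map suc (upTo n)

------------------------------------------------------------------------
-- Dyck paths

data Step : Set where
  N E : Step

_≟ˢ_ : DecidableEquality Step
N ≟ˢ N = yes refl
N ≟ˢ E = no λ ()
E ≟ˢ N = no λ ()
E ≟ˢ E = yes refl

norths easts : List Step → ℕ
norths d = length (filter (_≟ˢ N) d)
easts  d = length (filter (_≟ˢ E) d)

-- The lattice points visited by d are the points (easts u , norths u)
-- for u an initial segment of d.
IsDyckPath : ℕ → List Step → Set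
IsDyckPath n d =
  norths d ≡ n × easts d ≡ n × All (λ u → easts u ≤ norths u) (inits d)

isDyckPath? : ∀ n d → Dec (IsDyckPath n d)
isDyckPath? n d =
  (norths d ≟ n) ×-dec (easts d ≟ n) ×-dec
  All.all? (λ u → easts u ≤? norths u) (inits d)

-- northRunsFrom k d lists the lengths of the maximal runs of north steps
-- in d preceded by k further north steps.
northRunsFrom : ℕ → List Step → List ℕ
northRunsFrom k       (N ∷ d) = northRunsFrom (suc k) d
northRunsFrom zero    (E ∷ d) = northRunsFrom zero d
northRunsFrom (suc k) (E ∷ d) = suc k ∷ northRunsFrom zero d
northRunsFrom zero    []      = []
northRunsFrom (suc k) []      = [ suc k ]

w : List Step → List ℕ
w = northRunsFrom zero

------------------------------------------------------------------------
-- Parking functions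

data LabelledStep : Set where
  N : (label : ℕ) → LabelledStep
  E : LabelledStep

shape : LabelledStep → Step
shape (N _) = N
shape E     = E

label? : LabelledStep → Maybe ℕ
label? (N k) = just k
label? E     = nothing

path : List LabelledStep → List Step
path = map shape

φ : List LabelledStep → List ℕ
φ = mapMaybe label?

Increasing : LabelledStep → LabelledStep → Set
Increasing (N a) (N b) = a < b
Increasing (N _) E     = ⊤
Increasing E     _     = ⊤

increasing? : ∀ s t → Dec (Increasing s t)
increasing? (N a) (N b) = a <? b
increasing? (N _) E     = yes tt
increasing? E     _     = yes tt

-- Linked relates each step to the one immediately following it.
IsParkingFunction : ℕ → List LabelledStep → Set
IsParkingFunction n p =
  IsDyckPath n (path p) × φ p ↭ [1… n ] × Linked Increasing p

_↭?_ : (xs ys : List ℕ) → Dec (xs ↭ ys)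
[]       ↭? []       = yes ↭-refl
[]       ↭? (y ∷ ys) = no λ q → case-[] (↭-empty-inv (↭-sym q))
  where
  case-[] : ¬ (y ∷ ys ≡ [])
  case-[] ()
(x ∷ xs) ↭? ys with mem? _≟_ x ys
... | no  x∉ys = no λ q → x∉ys (∈-resp-↭ q (here refl))
... | yes x∈ys with ∈-∃++ x∈ys
...   | us , vs , refl =
  map′ (λ q → ↭-trans (prep x q) (↭-sym (shift x us vs)))
       (λ q → drop-∷ (↭-trans q (shift x us vs)))
       (xs ↭? (us ++ vs))

isParkingFunction? : ∀ n p → Dec (IsParkingFunction n p)
isParkingFunction? n p =
  isDyckPath? n (path p) ×-dec (φ p ↭? [1… n ]) ×-dec linked? increasing? p

------------------------------------------------------------------------
-- Pattern containment, for permutations in one-line notation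

IsOccurrence : (π ρ : List ℕ) → (Fin (length ρ) → Fin (length π)) → Set
IsOccurrence π ρ i =
  (∀ a b → a <ᶠ b → i a <ᶠ i b) ×
  (∀ a b → (lookup π (i a) ≤ lookup π (i b)) ⇔ (lookup ρ a ≤ lookup ρ b))

_Contains_ _Avoids_ : (π ρ : List ℕ) → Set
π Contains ρ = ∃ (IsOccurrence π ρ)
π Avoids   ρ = ¬ (π Contains ρ)

anyFun? : ∀ {m n} {P : (Fin m → Fin n) → Set} →
          (∀ {f g} → f ≗ g → P f → P g) → (∀ f → Dec (P f)) → Dec (∃ P)
anyFun? {zero} resp P? =
  map′ ([]ᶠ ,_) (λ (f , Pf) → resp (λ ()) Pf) (P? []ᶠ)
anyFun? {suc m} {P = P} resp P? =
  map′ (λ (x , f , Pf) → x ∷ᶠ f , Pf)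
       (λ (f , Pf) → f zero , f ∘ suc , resp (η f) Pf)
       (anyFin? λ x → anyFun? (λ f≗g → resp (cons-cong f≗g)) (λ f → P? (x ∷ᶠ f)))
  where
  η : ∀ {A : Set} (f : Fin (suc m) → A) → f ≗ (f zero ∷ᶠ f ∘ suc)
  η f zero    = refl
  η f (suc _) = refl

  cons-cong : ∀ {A : Set} {x : A} {f g : Fin m → A} →
              f ≗ g → (x ∷ᶠ f) ≗ (x ∷ᶠ g)
  cons-cong f≗g zero    = refl
  cons-cong f≗g (suc a) = f≗g a

_contains?_ : ∀ π ρ → Dec (π Contains ρ)
π contains? ρ = anyFun? resp occurrence?
  where
  resp : ∀ {i j} → i ≗ j → IsOccurrence π ρ i → IsOccurrence π ρ j
  resp i≗j (mono , iso) =
    (λ a b a<b → subst₂ _<ᶠ_ (i≗j a) (i≗j b) (mono a b a<b)) ,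
    (λ a b → subst₂ (λ x y → (lookup π x ≤ lookup π y) ⇔ (lookup ρ a ≤ lookup ρ b))
                    (i≗j a) (i≗j b) (iso a b))

  _⇔-dec_ : ∀ {A B : Set} → Dec A → Dec B → Dec (A ⇔ B)
  A? ⇔-dec B? = map′ (uncurry mk⇔) < Equivalence.to , Equivalence.from >
                     ((A? →-dec B?) ×-dec (B? →-dec A?))

  occurrence? : ∀ i → Dec (IsOccurrence π ρ i)
  occurrence? i =
    (all? λ a → all? λ b → (a <ᶠ? b) →-dec (i a <ᶠ? i b)) ×-dec
    (all? λ a → all? λ b →
      (lookup π (i a) ≤? lookup π (i b)) ⇔-dec (lookup ρ a ≤? lookup ρ b))

_avoids?_ : ∀ π ρ → Dec (π Avoids ρ)
π avoids? ρ = ¬? (π contains? ρ)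

------------------------------------------------------------------------
-- Enumeration

words : ∀ {A : Set} → List A → ℕ → List (List A)
words as zero    = [ [] ]
words as (suc k) = cartesianProductWith _∷_ as (words as k)

steps : List Step
steps = N ∷ E ∷ []

labelledSteps : ℕ → List LabelledStep
labelledSteps n = E ∷ map N [1… n ]

𝒟 : ℕ → List (List Step)
𝒟 n = filter (isDyckPath? n) (words steps (n + n))

IsAvoidingPF : ℕ → List (List ℕ) → List LabelledStep → Set
IsAvoidingPF n ρs p = IsParkingFunction n p × All (φ p Avoids_) ρs

isAvoidingPF? : ∀ n ρs p → Dec (IsAvoidingPF n ρs p)
isAvoidingPF? n ρs p = isParkingFunction? n p ×-dec All.all? (φ p avoids?_) ρs

avoidingPFs : ℕ → List (List ℕ) → List (List LabelledStep)
avoidingPFs n ρs =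
  filter (isAvoidingPF? n ρs) (words (labelledSteps n) (n + n))

pf : ℕ → List (List ℕ) → ℕ
pf n ρs = length (avoidingPFs n ρs)

------------------------------------------------------------------------
-- The enumerations 𝒟 and avoidingPFs are complete and repetition-free.

∈-words : ∀ {A : Set} {as : List A} xs → All (_∈ as) xs → xs ∈ words as (length xs)
∈-words []       []            = here refl
∈-words (x ∷ xs) (x∈ ∷ xs∈)  = ∈-cartesianProductWith⁺ _∷_ x∈ (∈-words xs xs∈)

words-unique : ∀ {A : Set} {as : List A} → Unique as → ∀ k → Unique (words as k)
words-unique as! zero    = [] ∷ []
words-unique as! (suc k) =
  Unique.cartesianProductWith⁺ _∷_ ∷-injective as! (words-unique as! k)

length≡norths+easts : ∀ d → length d ≡ norths d + easts d
length≡norths+easts []      = refl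
length≡norths+easts (N ∷ d) = cong suc (length≡norths+easts d)
length≡norths+easts (E ∷ d) =
  trans (cong suc (length≡norths+easts d)) (sym (+-suc (norths d) (easts d)))

length-path : ∀ p → length (path p) ≡ length p
length-path []      = refl
length-path (_ ∷ p) = cong suc (length-path p)

length-dyck : ∀ {n d} → IsDyckPath n d → length d ≡ n + n
length-dyck {d = d} (#N , #E , _) =
  trans (length≡norths+easts d) (cong₂ _+_ #N #E)

∈-𝒟 : ∀ n d → d ∈ 𝒟 n ⇔ IsDyckPath n d
∈-𝒟 n d = mk⇔
  (λ d∈ → proj₂ (∈-filter⁻ (isDyckPath? n) {xs = words steps (n + n)} d∈))
  (λ D → ∈-filter⁺ (isDyckPath? n)
    (subst (λ k → d ∈ words steps k) (length-dyck D)
      (∈-words d (All.universal (λ { N → here refl ; E → there (here refl) }) d)))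
    D)

𝒟-unique : ∀ n → Unique (𝒟 n)
𝒟-unique n = Unique.filter⁺ (isDyckPath? n)
  (words-unique (((λ ()) ∷ []) ∷ [] ∷ []) (n + n))

labels-in-alphabet : ∀ {ks} p → All (_∈ ks) (φ p) → All (_∈ (E ∷ map N ks)) p
labels-in-alphabet []        _          = []
labels-in-alphabet (N k ∷ p) (k∈ ∷ ks∈) =
  there (∈-map⁺ N k∈) ∷ labels-in-alphabet p ks∈
labels-in-alphabet (E ∷ p)   ks∈        = here refl ∷ labels-in-alphabet p ks∈

∈-avoidingPFs : ∀ n ρs p → p ∈ avoidingPFs n ρs ⇔ IsAvoidingPF n ρs p
∈-avoidingPFs n ρs p = mk⇔
  (λ p∈ → proj₂ (∈-filter⁻ (isAvoidingPF? n ρs) {xs = words (labelledSteps n) (n + n)} p∈))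
  (λ { P@((D , φ↭ , _) , _) → ∈-filter⁺ (isAvoidingPF? n ρs)
    (subst (λ k → p ∈ words (labelledSteps n) k) (trans (sym (length-path p)) (length-dyck D))
      (∈-words p (labels-in-alphabet p (All.tabulate (∈-resp-↭ φ↭)))))
    P })

avoidingPFs-unique : ∀ n ρs → Unique (avoidingPFs n ρs)
avoidingPFs-unique n ρs = Unique.filter⁺ (isAvoidingPF? n ρs)
  (words-unique (All.tabulate E∉ ∷ Unique.map⁺ (λ { refl → refl })
                                   (Unique.map⁺ suc-injective (Unique.upTo⁺ n)))
                (n + n))
  where
  E∉ : ∀ {s} → s ∈ map N [1… n ] → E ≢ s
  E∉ s∈ refl with ∈-map⁻ N s∈
  ... | _ , _ , ()

{-# OPTIONS --safe #-}

-- An entry of a permutation avoiding 312 and 321 has at most one smaller entry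
-- to its right.  Hence, reading such a permutation from the left, the values
-- not yet read always form a set {m} ∪ {j, j + 1, …} with m < j, and the next
-- value is m or j; after the last step nothing is pending, so the last value
-- is m.  Taking m just after taking j is the only way to create a descent, so
-- along a run of k north steps one takes m some number a ≤ k of times and j
-- the other k − a times.  This gives k + 1 choices, except in the last run,
-- where a = k.

module Submission where

open import Defs
open import Data.Empty using (⊥)
open import Data.Fin using (Fin; zero; suc) renaming (_<_ to _<ᶠ_)
open import Data.Fin.Properties using () renaming (<-cmp to <ᶠ-cmp)
open import Data.List using (List; []; _∷_; _++_; length; map; take; concatMap; applyUpTo; lookup)
open import Data.List.Membership.Propositional using (_∈_; find; lose)
open import Data.List.Membership.Propositional.Properties
  using (∈-map⁺; ∈-map⁻; ∈-++⁺ˡ; ∈-++⁺ʳ; ∈-++⁻; ∈-concatMap⁺; ∈-concatMap⁻; ∈-lookup)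
open import Data.List.Membership.Propositional.Properties.WithK using (unique∧set⇒bag)
open import Data.List.Properties using (length-++; length-map; map-cong; map-upTo; ∷-injectiveʳ)
open import Data.List.Relation.Binary.BagAndSetEquality using (∼bag⇒↭)
open import Data.List.Relation.Binary.Permutation.Propositional using (_↭_; ↭-refl; ↭-sym; ↭-trans; prep; swap; ↭⇒↭ₛ)
open import Data.List.Relation.Binary.Permutation.Propositional.Properties using (∈-resp-↭; All-resp-↭; drop-∷; ↭-length)
import Data.List.Relation.Binary.Permutation.Setoid.Properties as Permutation
open import Data.List.Relation.Unary.All as All using (All; []; _∷_)
import Data.List.Relation.Unary.All.Properties as All
open import Data.List.Relation.Unary.AllPairs as AllPairs using (AllPairs; []; _∷_)
import Data.List.Relation.Unary.AllPairs.Properties as AllPairs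
open import Data.List.Relation.Unary.Any as Any using (here; there)
open import Data.List.Relation.Unary.Any.Properties using (lookup-index)
open import Data.List.Relation.Unary.Linked as Linked using (Linked; [-]; _∷_)
open import Data.List.Relation.Unary.Unique.Propositional using (Unique)
import Data.List.Relation.Unary.Unique.Propositional.Properties as Unique
open import Data.Nat using (ℕ; zero; suc; _+_; _*_; _∸_; _≤_; _<_; _≥_; z≤n; s≤s; z<s; s<s⁻¹)
open import Data.Nat.ListAction using (sum; product)
open import Data.Nat.Properties
open import Data.Product using (∃₂; _×_; _,_; proj₁; proj₂)
open import Data.Sum using (_⊎_; inj₁; inj₂)
open import Data.Unit using (tt)
open import Data.Vec.Functional using () renaming ([] to []ᶠ; _∷_ to _∷ᶠ_)
open import Function using (_∘_; _⇔_; mk⇔; Equivalence)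
open import Relation.Binary using (tri<; tri≈; tri>)
open import Relation.Binary.PropositionalEquality using (_≡_; _≢_; refl; sym; trans; cong; cong₂; subst; setoid; module ≡-Reasoning)
open import Relation.Nullary using (¬_; contradiction)

-- Avoidance of 312 and 321

[312] [321] : List ℕ
[312] = 3 ∷ 1 ∷ 2 ∷ []
[321] = 3 ∷ 2 ∷ 1 ∷ []

AtMostOneLaterSmaller : List ℕ → Set
AtMostOneLaterSmaller xs = ∀ i j k → i <ᶠ j → j <ᶠ k →
  lookup xs j < lookup xs i → lookup xs k < lookup xs i → ⊥

AllPairs-lookup : ∀ {A : Set} {R : A → A → Set} {xs} → AllPairs R xs →
                  ∀ i j → i <ᶠ j → R (lookup xs i) (lookup xs j)
AllPairs-lookup (x∼ ∷ _)  zero    (suc j) _   = All.lookup x∼ (∈-lookup j)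
AllPairs-lookup (_ ∷ xs∼) (suc i) (suc j) i<j = AllPairs-lookup xs∼ i j (s<s⁻¹ i<j)

both : ∀ {A B : Set} → A → B → A ⇔ B
both a b = mk⇔ (λ _ → b) (λ _ → a)

neither : ∀ {A B : Set} → ¬ A → ¬ B → A ⇔ B
neither ¬a ¬b = mk⇔ (λ a → contradiction a ¬a) (λ b → contradiction b ¬b)

triple-mono : ∀ {n} {i j k : Fin n} → i <ᶠ j → j <ᶠ k →
              ∀ a b → a <ᶠ b → (i ∷ᶠ j ∷ᶠ k ∷ᶠ []ᶠ) a <ᶠ (i ∷ᶠ j ∷ᶠ k ∷ᶠ []ᶠ) b
triple-mono i<j j<k zero             (suc zero)       _ = i<j
triple-mono i<j j<k zero             (suc (suc zero)) _ = <-trans i<j j<k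
triple-mono i<j j<k (suc zero)       (suc (suc zero)) _ = j<k
triple-mono i<j j<k (suc zero)       (suc zero)       (s≤s ())
triple-mono i<j j<k (suc (suc zero)) (suc zero)       (s≤s ())
triple-mono i<j j<k (suc (suc zero)) (suc (suc zero)) (s≤s (s≤s ()))

contains-312 : ∀ xs i j k → i <ᶠ j → j <ᶠ k →
               lookup xs j < lookup xs k → lookup xs k < lookup xs i → xs Contains [312]
contains-312 xs i j k i<j j<k y<z z<x = i ∷ᶠ j ∷ᶠ k ∷ᶠ []ᶠ , triple-mono i<j j<k , iso
  where
  iso : ∀ a b → (lookup xs ((i ∷ᶠ j ∷ᶠ k ∷ᶠ []ᶠ) a) ≤ lookup xs ((i ∷ᶠ j ∷ᶠ k ∷ᶠ []ᶠ) b)) ⇔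
                (lookup [312] a ≤ lookup [312] b)
  iso zero             zero             = both ≤-refl ≤-refl
  iso zero             (suc zero)       = neither (<⇒≱ (<-trans y<z z<x)) λ { (s≤s ()) }
  iso zero             (suc (suc zero)) = neither (<⇒≱ z<x) λ { (s≤s (s≤s ())) }
  iso (suc zero)       zero             = both (<⇒≤ (<-trans y<z z<x)) (s≤s z≤n)
  iso (suc zero)       (suc zero)       = both ≤-refl ≤-refl
  iso (suc zero)       (suc (suc zero)) = both (<⇒≤ y<z) (s≤s z≤n)
  iso (suc (suc zero)) zero             = both (<⇒≤ z<x) (s≤s (s≤s z≤n))
  iso (suc (suc zero)) (suc zero)       = neither (<⇒≱ y<z) λ { (s≤s ()) }
  iso (suc (suc zero)) (suc (suc zero)) = both ≤-refl ≤-refl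

contains-321 : ∀ xs i j k → i <ᶠ j → j <ᶠ k →
               lookup xs j < lookup xs i → lookup xs k < lookup xs j → xs Contains [321]
contains-321 xs i j k i<j j<k y<x z<y = i ∷ᶠ j ∷ᶠ k ∷ᶠ []ᶠ , triple-mono i<j j<k , iso
  where
  iso : ∀ a b → (lookup xs ((i ∷ᶠ j ∷ᶠ k ∷ᶠ []ᶠ) a) ≤ lookup xs ((i ∷ᶠ j ∷ᶠ k ∷ᶠ []ᶠ) b)) ⇔
                (lookup [321] a ≤ lookup [321] b)
  iso zero             zero             = both ≤-refl ≤-refl
  iso zero             (suc zero)       = neither (<⇒≱ y<x) λ { (s≤s (s≤s ())) }
  iso zero             (suc (suc zero)) = neither (<⇒≱ (<-trans z<y y<x)) λ { (s≤s ()) }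
  iso (suc zero)       zero             = both (<⇒≤ y<x) (s≤s (s≤s z≤n))
  iso (suc zero)       (suc zero)       = both ≤-refl ≤-refl
  iso (suc zero)       (suc (suc zero)) = neither (<⇒≱ z<y) λ { (s≤s ()) }
  iso (suc (suc zero)) zero             = both (<⇒≤ (<-trans z<y y<x)) (s≤s z≤n)
  iso (suc (suc zero)) (suc zero)       = both (<⇒≤ z<y) (s≤s z≤n)
  iso (suc (suc zero)) (suc (suc zero)) = both ≤-refl ≤-refl

-- The two smaller entries stand at different positions, so they are distinct. If they ascend they
-- complete a 312, if they descend a 321.
avoids⇒atMostOne : ∀ {xs} → Unique xs → All (xs Avoids_) ([312] ∷ [321] ∷ []) →
                   AtMostOneLaterSmaller xs
avoids⇒atMostOne {xs} xs! (av312 ∷ av321 ∷ []) i j k i<j j<k y<x z<x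
  with <-cmp (lookup xs j) (lookup xs k)
... | tri< y<z _ _ = av312 (contains-312 xs i j k i<j j<k y<z z<x)
... | tri≈ _ y≡z _ = AllPairs-lookup xs! j k j<k y≡z
... | tri> _ _ z<y = av321 (contains-321 xs i j k i<j j<k y<x z<y)

-- In both patterns the 3 comes first, so the other two entries of an occurrence are later and
-- smaller. Strictness comes from the failure of 3 ≤ 1 and of 3 ≤ 2.
atMostOne⇒avoids : ∀ {xs} → AtMostOneLaterSmaller xs → All (xs Avoids_) ([312] ∷ [321] ∷ [])
atMostOne⇒avoids {xs} one =
  (λ (f , mono , iso) → one (f zero) (f (suc zero)) (f (suc (suc zero)))
    (mono _ _ z<s) (mono _ _ (s≤s z<s))
    (≰⇒> λ le → case-31 (Equivalence.to (iso zero (suc zero)) le))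
    (≰⇒> λ le → case-32 (Equivalence.to (iso zero (suc (suc zero))) le))) ∷
  (λ (f , mono , iso) → one (f zero) (f (suc zero)) (f (suc (suc zero)))
    (mono _ _ z<s) (mono _ _ (s≤s z<s))
    (≰⇒> λ le → case-32 (Equivalence.to (iso zero (suc zero)) le))
    (≰⇒> λ le → case-31 (Equivalence.to (iso zero (suc (suc zero))) le))) ∷ []
  where
  case-31 : ¬ (3 ≤ 1)
  case-31 (s≤s ())
  case-32 : ¬ (3 ≤ 2)
  case-32 (s≤s (s≤s ()))

atMostOne-tail : ∀ {x xs} → AtMostOneLaterSmaller (x ∷ xs) → AtMostOneLaterSmaller xs
atMostOne-tail one i j k i<j j<k = one (suc i) (suc j) (suc k) (s≤s i<j) (s≤s j<k)

-- Distinct values sit at distinct positions, but either may come first, hence the trichotomy on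
-- indices.
atMostOne-head : ∀ {x y z xs} → AtMostOneLaterSmaller (x ∷ xs) →
                 y ∈ xs → z ∈ xs → y ≢ z → y < x → ¬ z < x
atMostOne-head {x} {xs = xs} one y∈ z∈ y≢z y<x z<x
  with <ᶠ-cmp (Any.index y∈) (Any.index z∈)
... | tri< i<j _ _ = one zero (suc (Any.index y∈)) (suc (Any.index z∈)) z<s (s≤s i<j)
      (subst (_< x) (lookup-index y∈) y<x) (subst (_< x) (lookup-index z∈) z<x)
... | tri≈ _ i≡j _ = y≢z (trans (lookup-index y∈) (trans (cong (lookup xs) i≡j) (sym (lookup-index z∈))))
... | tri> _ _ j<i = one zero (suc (Any.index z∈)) (suc (Any.index y∈)) z<s (s≤s j<i)
      (subst (_< x) (lookup-index z∈) z<x) (subst (_< x) (lookup-index y∈) y<x)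

atMostOne-min-∷ : ∀ {x xs} → All (x ≤_) xs → AtMostOneLaterSmaller xs →
                  AtMostOneLaterSmaller (x ∷ xs)
atMostOne-min-∷ x≤ one zero    (suc j) _       _   _   y<x _ = <⇒≱ y<x (All.lookup x≤ (∈-lookup j))
atMostOne-min-∷ x≤ one (suc i) (suc j) (suc k) i<j j<k y<x z<x =
  one i j k (s<s⁻¹ i<j) (s<s⁻¹ j<k) y<x z<x

-- Only `m` can be below `x`, and two later smaller positions would both hold it, against
-- uniqueness. This serves the case where `j` is taken while `m` stays pending.
atMostOne-∷ : ∀ {m x xs ys} → Unique xs → xs ↭ m ∷ ys → All (x ≤_) ys →
              AtMostOneLaterSmaller xs → AtMostOneLaterSmaller (x ∷ xs)
atMostOne-∷ {m} {x} {xs} xs! xs↭ x≤ one zero (suc j) (suc k) _ j<k y<x z<x =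
  AllPairs-lookup xs! j k (s<s⁻¹ j<k) (trans (smaller≡m (∈-lookup j) y<x) (sym (smaller≡m (∈-lookup k) z<x)))
  where
  smaller≡m : ∀ {y} → y ∈ xs → y < x → y ≡ m
  smaller≡m y∈ y<x with ∈-resp-↭ xs↭ y∈
  ... | here y≡m  = y≡m
  ... | there y∈′ = contradiction (All.lookup x≤ y∈′) (<⇒≱ y<x)
atMostOne-∷ xs! xs↭ x≤ one (suc i) (suc j) (suc k) i<j j<k y<x z<x =
  one i j k (s<s⁻¹ i<j) (s<s⁻¹ j<k) y<x z<x

-- The values not yet read

Unique-resp-↭ : ∀ {xs ys : List ℕ} → xs ↭ ys → Unique xs → Unique ys
Unique-resp-↭ xs↭ys = Permutation.Unique-resp-↭ (setoid ℕ) (↭⇒↭ₛ xs↭ys)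

-- The k values m, j, j + 1, …, j + k − 2.
unread : (m j k : ℕ) → List ℕ
unread m j zero    = []
unread m j (suc k) = m ∷ unread j (suc j) k

unread-≥ : ∀ {l m j} → l ≤ m → m < j → ∀ k → All (l ≤_) (unread m j k)
unread-≥ l≤m m<j zero    = []
unread-≥ l≤m m<j (suc k) = l≤m ∷ unread-≥ (≤-trans l≤m (<⇒≤ m<j)) ≤-refl k

unread-unique : ∀ {m j} → m < j → ∀ k → Unique (unread m j k)
unread-unique m<j zero    = []
unread-unique m<j (suc k) = All.map <⇒≢ (unread-≥ m<j ≤-refl k) ∷ unread-unique ≤-refl k

-- `f` is kept general because `applyUpTo` recurses on `f ∘ suc`; the offset `m` absorbs the shift.
unread≡applyUpTo : ∀ m (f : ℕ → ℕ) → (∀ i → f i ≡ i + m) → ∀ k →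
                   unread m (suc m) k ≡ applyUpTo f k
unread≡applyUpTo m f f≡ zero    = refl
unread≡applyUpTo m f f≡ (suc k) =
  cong₂ _∷_ (sym (f≡ 0))
    (unread≡applyUpTo (suc m) (f ∘ suc) (λ i → trans (f≡ (suc i)) (sym (+-suc i m))) k)

unread≡[1…] : ∀ n → unread 1 2 n ≡ [1… n ]
unread≡[1…] n = trans (unread≡applyUpTo 1 suc (λ i → +-comm 1 i) n) (sym (map-upTo suc n))

-- Reading a value beyond `j` would leave both `m` and `j` for later, two smaller entries. In the
-- second alternative `0 < k` records that `m` is still unread.
next-unread : ∀ {a xs m j k} → m < j → a ∷ xs ↭ unread m j (suc k) →
              AtMostOneLaterSmaller (a ∷ xs) →
              (a ≡ m × xs ↭ unread j (suc j) k) ⊎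
              (a ≡ j × 0 < k × xs ↭ unread m (suc j) k)
next-unread {k = k} m<j p one with ∈-resp-↭ p (here refl)
next-unread {k = k} m<j p one | here refl = inj₁ (refl , drop-∷ p)
next-unread {k = suc k} m<j p one | there (here refl) =
  -- `j` is second in the list; swapping it with `m` puts it first, where it cancels against the
  -- value just read.
  inj₂ (refl , z<s , drop-∷ (↭-trans p (swap _ _ ↭-refl)))
next-unread {a} {xs} {m} {j} {suc k} m<j p one | there (there a∈) =
  contradiction j<a (atMostOne-head one (later (here refl) m≢a) (later (there (here refl)) (<⇒≢ j<a))
                       (<⇒≢ m<j) (<-trans m<j j<a))
  where
  j<a : j < a
  j<a = All.lookup (unread-≥ ≤-refl ≤-refl k) a∈
  m≢a : m ≢ a
  m≢a = <⇒≢ (<-trans m<j j<a)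
  later : ∀ {y} → y ∈ unread m j (suc (suc k)) → y ≢ a → y ∈ xs
  later y∈ y≢a with ∈-resp-↭ (↭-sym p) y∈
  ... | here y≡a  = contradiction y≡a y≢a
  ... | there y∈′ = y∈′

-- Labellings of a fixed path

unlessZero : ∀ {A : Set} → ℕ → List A → List A
unlessZero zero    _  = []
unlessZero (suc _) xs = xs

∈-unlessZero⁻ : ∀ {A : Set} {x : A} k {xs} → x ∈ unlessZero k xs → 0 < k × x ∈ xs
∈-unlessZero⁻ (suc k) x∈ = z<s , x∈

∈-unlessZero⁺ : ∀ {A : Set} {x : A} {k xs} → 0 < k → x ∈ xs → x ∈ unlessZero k xs
∈-unlessZero⁺ {k = suc k} _ x∈ = x∈

-- labellings m j d lists the labellings of d by unread m j (norths d), and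
-- raised m j d those that may follow a step N l with m < l < j; as m is still
-- to be read, the latter needs a further run of north steps.
labellings raised : (m j : ℕ) → List Step → List (List LabelledStep)
labellings m j []      = [] ∷ []
labellings m j (N ∷ d) = map (N m ∷_) (labellings j (suc j) d) ++ map (N j ∷_) (raised m (suc j) d)
labellings m j (E ∷ d) = map (E ∷_) (labellings m j d)
raised m j []      = []
raised m j (N ∷ d) = map (N j ∷_) (raised m (suc j) d)
raised m j (E ∷ d) = unlessZero (norths d) (map (E ∷_) (labellings m j d))

-- Shape and distinctness of the listed labellings

labellings-path : ∀ {m j} d {p} → p ∈ labellings m j d → path p ≡ d
raised-path     : ∀ {m j} d {p} → p ∈ raised m j d → path p ≡ d
labellings-path []      (here refl) = refl
labellings-path {m} {j} (N ∷ d) p∈ with ∈-++⁻ (map (N m ∷_) (labellings j (suc j) d)) p∈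
... | inj₁ p∈′ with ∈-map⁻ (N m ∷_) p∈′
...   | _ , q∈ , refl = cong (N ∷_) (labellings-path d q∈)
labellings-path {m} {j} (N ∷ d) p∈ | inj₂ p∈′ with ∈-map⁻ (N j ∷_) p∈′
...   | _ , q∈ , refl = cong (N ∷_) (raised-path d q∈)
labellings-path (E ∷ d) p∈ with ∈-map⁻ (E ∷_) p∈
... | _ , q∈ , refl = cong (E ∷_) (labellings-path d q∈)
raised-path {m} {j} (N ∷ d) p∈ with ∈-map⁻ (N j ∷_) p∈
... | _ , q∈ , refl = cong (N ∷_) (raised-path d q∈)
raised-path (E ∷ d) p∈ with ∈-map⁻ (E ∷_) (proj₂ (∈-unlessZero⁻ (norths d) p∈))
... | _ , q∈ , refl = cong (E ∷_) (labellings-path d q∈)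

-- The two branches at a north step begin with the labels `m` and `j`, which differ.
labellings-unique : ∀ {m j} → m < j → ∀ d → Unique (labellings m j d)
raised-unique     : ∀ {m j} → m < j → ∀ d → Unique (raised m j d)
labellings-unique m<j []      = [] ∷ []
labellings-unique {m} {j} m<j (N ∷ d) =
  Unique.++⁺ (Unique.map⁺ ∷-injectiveʳ (labellings-unique ≤-refl d))
             (Unique.map⁺ ∷-injectiveʳ (raised-unique (m<n⇒m<1+n m<j) d))
             disjoint
  where
  disjoint : ∀ {p} → ¬ (p ∈ map (N m ∷_) (labellings j (suc j) d) ×
                        p ∈ map (N j ∷_) (raised m (suc j) d))
  disjoint (p∈₁ , p∈₂) with ∈-map⁻ (N m ∷_) p∈₁
  ... | _ , _ , refl with ∈-map⁻ (N j ∷_) p∈₂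
  ...   | _ , _ , refl = <-irrefl refl m<j
labellings-unique m<j (E ∷ d) = Unique.map⁺ ∷-injectiveʳ (labellings-unique m<j d)
raised-unique m<j []      = []
raised-unique m<j (N ∷ d) = Unique.map⁺ ∷-injectiveʳ (raised-unique (m<n⇒m<1+n m<j) d)
raised-unique m<j (E ∷ d) with norths d
... | zero  = []
... | suc _ = Unique.map⁺ ∷-injectiveʳ (labellings-unique m<j d)

-- Completeness of the lists

increasing-≤ : ∀ s {m j} → m ≤ j → Increasing s (N m) → Increasing s (N j)
increasing-≤ (N _) m≤j l<m = <-≤-trans l<m m≤j
increasing-≤ E     _   _   = tt

-- Induction along the path: at a north step `next-unread` leaves two values, matching the two
-- branches of `labellings`. Keeping the preceding step `s` in view makes the ascent across the cut
-- available.
labellings-complete : ∀ {m j s} p → m < j → φ p ↭ unread m j (norths (path p)) →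
  AtMostOneLaterSmaller (φ p) → Linked Increasing (s ∷ p) → p ∈ labellings m j (path p)
raised-complete : ∀ {m j l} p → m < l → l < j → 0 < norths (path p) →
  φ p ↭ unread m j (norths (path p)) →
  AtMostOneLaterSmaller (φ p) → Linked Increasing (N l ∷ p) → p ∈ raised m j (path p)
labellings-complete []      m<j _ _ _ = here refl
labellings-complete {m} {j} (N a ∷ p) m<j φ↭ one (_ ∷ inc) with next-unread m<j φ↭ one
... | inj₁ (refl , φ↭′) =
  ∈-++⁺ˡ (∈-map⁺ (N m ∷_) (labellings-complete p ≤-refl φ↭′ (atMostOne-tail one) inc))
... | inj₂ (refl , 0<k , φ↭′) =
  ∈-++⁺ʳ (map (N m ∷_) (labellings j (suc j) (path p)))
    (∈-map⁺ (N j ∷_) (raised-complete p m<j ≤-refl 0<k φ↭′ (atMostOne-tail one) inc))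
labellings-complete (E ∷ p) m<j φ↭ one (_ ∷ inc) =
  ∈-map⁺ (E ∷_) (labellings-complete p m<j φ↭ one inc)
raised-complete {m} {j} (N a ∷ p) m<l l<j _ φ↭ one (l<a ∷ inc)
  with next-unread (<-trans m<l l<j) φ↭ one
-- Taking `m` directly after the larger `l` would be a descent within a run.
... | inj₁ (refl , _) = contradiction l<a (<-asym m<l)
... | inj₂ (refl , 0<k , φ↭′) =
  ∈-map⁺ (N j ∷_) (raised-complete p (<-trans m<l l<j) ≤-refl 0<k φ↭′ (atMostOne-tail one) inc)
raised-complete (E ∷ p) m<l l<j 0<k φ↭ one (_ ∷ inc) =
  ∈-unlessZero⁺ 0<k (∈-map⁺ (E ∷_) (labellings-complete p (<-trans m<l l<j) φ↭ one inc))

-- Soundness of the lists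

raised⇒0<norths : ∀ {m j} d {p} → p ∈ raised m j d → 0 < norths d
raised⇒0<norths (N ∷ d) _  = z<s
raised⇒0<norths (E ∷ d) p∈ = proj₁ (∈-unlessZero⁻ (norths d) p∈)

Admissible : ℕ → ℕ → List Step → LabelledStep → List LabelledStep → Set
Admissible m j d s p =
  φ p ↭ unread m j (norths d) × AtMostOneLaterSmaller (φ p) × Linked Increasing (s ∷ p)

-- The common case of taking `j`. A remaining north step guarantees that `m` heads the unread list,
-- so `j` can be swapped in behind it; `m` is then the only later entry below `j`.
admissible-raise : ∀ {m j d s p} → m < j → 0 < norths d → Increasing s (N j) →
                   Admissible m (suc j) d (N j) p → Admissible m j (N ∷ d) s (N j ∷ p)
admissible-raise {m} {j} {d} m<j 0<k s<j (φ↭ , one , inc) with norths d | 0<k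
... | suc k | _ =
  ↭-trans (prep j φ↭) (swap _ _ ↭-refl) ,
  atMostOne-∷ (Unique-resp-↭ (↭-sym φ↭) (unread-unique (m<n⇒m<1+n m<j) (suc k))) φ↭
    (unread-≥ (n≤1+n j) ≤-refl k) one ,
  s<j ∷ inc

-- `m` is the least unread value, so an ascent from `s` to `m` covers both possible next labels.
-- After a raise only `j` may follow in the same run, and `l < j` is what is required.
labellings-sound : ∀ {m j s} d {p} → m < j → Increasing s (N m) →
                   p ∈ labellings m j d → Admissible m j d s p
raised-sound : ∀ {m j l} d {p} → m < l → l < j →
               p ∈ raised m j d → Admissible m j d (N l) p
labellings-sound []      m<j s<m (here refl) = ↭-refl , (λ ()) , [-]
labellings-sound {m} {j} {s} (N ∷ d) m<j s<m p∈ with ∈-++⁻ (map (N m ∷_) (labellings j (suc j) d)) p∈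
... | inj₁ p∈′ with ∈-map⁻ (N m ∷_) p∈′
...   | _ , q∈ , refl with labellings-sound {s = N m} d ≤-refl m<j q∈
...     | φ↭ , one , inc =
  prep m φ↭ ,
  atMostOne-min-∷ (All-resp-↭ (↭-sym φ↭) (unread-≥ (<⇒≤ m<j) ≤-refl (norths d))) one ,
  s<m ∷ inc
labellings-sound {m} {j} {s} (N ∷ d) m<j s<m p∈ | inj₂ p∈′ with ∈-map⁻ (N j ∷_) p∈′
...   | _ , q∈ , refl =
  admissible-raise {d = d} {s} m<j (raised⇒0<norths d q∈) (increasing-≤ s (<⇒≤ m<j) s<m)
    (raised-sound d m<j ≤-refl q∈)
labellings-sound {s = s} (E ∷ d) m<j s<m p∈ with ∈-map⁻ (E ∷_) p∈
... | _ , q∈ , refl with labellings-sound {s = E} d m<j tt q∈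
...   | φ↭ , one , inc = φ↭ , one , increasing-E s ∷ inc
  where
  increasing-E : ∀ s → Increasing s E
  increasing-E (N _) = tt
  increasing-E E     = tt
raised-sound {m} {j} {l} (N ∷ d) m<l l<j p∈ with ∈-map⁻ (N j ∷_) p∈
... | _ , q∈ , refl =
  admissible-raise {d = d} {N l} (<-trans m<l l<j) (raised⇒0<norths d q∈) l<j
    (raised-sound d (<-trans m<l l<j) ≤-refl q∈)
raised-sound (E ∷ d) m<l l<j p∈ with ∈-map⁻ (E ∷_) (proj₂ (∈-unlessZero⁻ (norths d) p∈))
... | _ , q∈ , refl with labellings-sound {s = E} d (<-trans m<l l<j) tt q∈
...   | φ↭ , one , inc = φ↭ , one , tt ∷ inc

-- Counting the labellings of a path

weight : List ℕ → ℕ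
weight ws = product (map (_+ 1) (take (length ws ∸ 1) ws))

-- Together with `runs-empty` this tells whether a run is the last one, and so whether it
-- contributes a factor to `weight`.
runs-nonempty : ∀ k d → 0 < k + norths d → ∃₂ λ x xs → northRunsFrom k d ≡ x ∷ xs
runs-nonempty (suc k) []      _ = _ , _ , refl
runs-nonempty k       (N ∷ d) _ = runs-nonempty (suc k) d z<s
runs-nonempty zero    (E ∷ d) 0<k = runs-nonempty zero d 0<k
runs-nonempty (suc k) (E ∷ d) _ = _ , _ , refl

runs-empty : ∀ d → norths d ≡ 0 → w d ≡ []
runs-empty []      _ = refl
runs-empty (E ∷ d) k≡0 = runs-empty d k≡0

length-labellings-E : ∀ {m j} d → length (labellings m j d) ≡ length (labellings m j (E ∷ d))
length-labellings-E {m} {j} d = sym (length-map (E ∷_) (labellings m j d))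

-- The north steps of a run that starts before d may stop taking the pending
-- value at any of k places before d, all leading to raised labellings of d.
weight-runs : ∀ k {m j m′ j′} d → weight (northRunsFrom k d) ≡
              length (labellings m j d) + k * length (raised m′ j′ d)
weight-labellings : ∀ {m j} d → weight (w d) ≡ length (labellings m j d)
weight-runs zero    [] = refl
weight-runs (suc k) [] = cong suc (sym (*-zeroʳ k))
-- Of the `suc k` raised terms for `d`, one counts the labellings that switch to `j` at this very
-- step; the other `k` switched earlier. The label parameters of the two terms are independent
-- because `L` has `j` pending while `R` keeps `m`.
weight-runs k {m} {j} {m′} {j′} (N ∷ d) = begin
  weight (northRunsFrom (suc k) d)
    ≡⟨ weight-runs (suc k) d ⟩
  length L + (length R′ + k * length R′)
    ≡⟨ +-assoc (length L) _ _ ⟨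
  length L + length R′ + k * length R′
    ≡⟨ cong (λ r → length L + r + k * length R′) same-length ⟩
  length L + length R + k * length R′
    ≡⟨ cong₂ (λ a b → a + b + k * length R′) (length-map (N m ∷_) L) (length-map (N j ∷_) R) ⟨
  length (map (N m ∷_) L) + length (map (N j ∷_) R) + k * length R′
    ≡⟨ cong₂ (λ a b → a + k * b) (length-++ (map (N m ∷_) L)) (length-map (N j′ ∷_) R′) ⟨
  length (labellings m j (N ∷ d)) + k * length (raised m′ j′ (N ∷ d)) ∎
  where
  open ≡-Reasoning
  L = labellings j (suc j) d
  R = raised m (suc j) d
  R′ = raised m′ (suc j′) d
  -- The left-hand side of weight-runs 1 d does not mention m′ and j′.
  same-length : length R′ ≡ length R
  same-length = +-cancelʳ-≡ 0 _ _ (+-cancelˡ-≡ (length L) _ _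
    (trans (sym (weight-runs 1 d)) (weight-runs 1 d)))
weight-runs zero {m} {j} (E ∷ d) =
  trans (trans (weight-labellings d) (length-labellings-E d)) (sym (+-identityʳ _))
weight-runs (suc k) {m} {j} {m′} {j′} (E ∷ d) with norths d in eq
-- No north step remains: the run just ended is the last one and has no factor, and there are no
-- raised labellings.
... | zero rewrite runs-empty d eq = begin
  1                                        ≡⟨ cong weight (runs-empty d eq) ⟨
  weight (w d)                             ≡⟨ trans (weight-labellings d) (length-labellings-E d) ⟩
  length (labellings m j (E ∷ d))          ≡⟨ +-identityʳ _ ⟨
  length (labellings m j (E ∷ d)) + 0      ≡⟨ cong (length (labellings m j (E ∷ d)) +_) (*-zeroʳ k) ⟨
  length (labellings m j (E ∷ d)) + k * 0  ∎
  where open ≡-Reasoning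
-- Another run follows. The east step lifts the ascent condition, so ordinary and raised labellings
-- are equally many, one plus `suc k` copies of `weight (w d)`.
... | suc _ with runs-nonempty zero d (subst (0 <_) (sym eq) z<s)
...   | x , xs , w≡ = begin
  weight (suc k ∷ w d)
    ≡⟨ cong (λ ws → weight (suc k ∷ ws)) w≡ ⟩
  (suc k + 1) * weight (x ∷ xs)
    ≡⟨ cong₂ (λ a ws → a * weight ws) (+-comm 1 (suc k)) w≡ ⟨
  weight (w d) + suc k * weight (w d)
    ≡⟨ cong₂ (λ a b → a + suc k * b) (trans (weight-labellings d) (length-labellings-E d))
                                  (trans (weight-labellings d) (length-labellings-E d)) ⟩
  length (labellings m j (E ∷ d)) + suc k * length (labellings m′ j′ (E ∷ d)) ∎
  where open ≡-Reasoning
-- The raised term is multiplied by zero, so its parameters are set arbitrarily to 0.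
weight-labellings d = trans (weight-runs zero {m′ = 0} {0} d) (+-identityʳ _)

-- Summation over all Dyck paths

length-concatMap : ∀ {A B : Set} (f : A → List B) xs →
                   length (concatMap f xs) ≡ sum (map (length ∘ f) xs)
length-concatMap f []       = refl
length-concatMap f (x ∷ xs) =
  trans (length-++ (f x)) (cong (length (f x) +_) (length-concatMap f xs))

-- `g` recovers from an element the index of its list, so lists with different indices are disjoint.
-- It is applied with `path` as `g`.
concatMap-unique : ∀ {A B : Set} {f : A → List B} (g : B → A) {xs} →
                   (∀ x {y} → y ∈ f x → g y ≡ x) → (∀ x → Unique (f x)) →
                   Unique xs → Unique (concatMap f xs)
concatMap-unique g g∘f f! xs! =
  Unique.concat⁺ (All.map⁺ (All.universal f! _))
    (AllPairs.map⁺ (AllPairs.map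
      (λ x≢x′ {_} (y∈ , y∈′) → x≢x′ (trans (sym (g∘f _ y∈)) (g∘f _ y∈′))) xs!))

isAvoidingPF⇒∈-labellings : ∀ n {p} → IsAvoidingPF n ([312] ∷ [321] ∷ []) p →
                            p ∈ labellings 1 2 (path p)
isAvoidingPF⇒∈-labellings n {p} (((norths≡n , _) , φ↭ , inc) , avoids) =
  -- At the start 1 is pending and 2 is next. The fictitious east step in front imposes no ascent
  -- condition.
  labellings-complete {s = E} p ≤-refl
    (subst (λ k → φ p ↭ unread 1 2 k) (sym norths≡n) φ↭′)
    (avoids⇒atMostOne {φ p} (Unique-resp-↭ (↭-sym φ↭′) (unread-unique ≤-refl n)) avoids)
    (E-∷ inc)
  where
  φ↭′ : φ p ↭ unread 1 2 n
  φ↭′ = subst (φ p ↭_) (sym (unread≡[1…] n)) φ↭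
  E-∷ : ∀ {p} → Linked Increasing p → Linked Increasing (E ∷ p)
  E-∷ {[]}    _   = [-]
  E-∷ {_ ∷ _} inc = tt ∷ inc

∈-labellings⇒isAvoidingPF : ∀ n d {p} → IsDyckPath n d → p ∈ labellings 1 2 d →
                            IsAvoidingPF n ([312] ∷ [321] ∷ []) p
∈-labellings⇒isAvoidingPF n d {p} dyck p∈ =
  let φ↭ , one , inc = labellings-sound {s = E} d ≤-refl tt p∈ in
  (subst (IsDyckPath n) (sym (labellings-path d p∈)) dyck ,
   subst (φ p ↭_) (trans (cong (unread 1 2) (proj₁ dyck)) (unread≡[1…] n)) φ↭ ,
   Linked.tail inc) ,
  atMostOne⇒avoids {φ p} one

∈-avoidingPFs⇔∈-labellings : ∀ n {p} →
  p ∈ avoidingPFs n ([312] ∷ [321] ∷ []) ⇔ p ∈ concatMap (labellings 1 2) (𝒟 n)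
∈-avoidingPFs⇔∈-labellings n {p} = mk⇔
  (λ p∈ → let isPF = Equivalence.to (∈-avoidingPFs n ([312] ∷ [321] ∷ []) p) p∈ in
    ∈-concatMap⁺ (labellings 1 2)
      (lose (Equivalence.from (∈-𝒟 n (path p)) (proj₁ (proj₁ isPF))) (isAvoidingPF⇒∈-labellings n isPF)))
  (λ p∈ → let d , d∈ , p∈L = find (∈-concatMap⁻ (labellings 1 2) {xs = 𝒟 n} p∈) in
    Equivalence.from (∈-avoidingPFs n ([312] ∷ [321] ∷ []) p)
      (∈-labellings⇒isAvoidingPF n d (Equivalence.to (∈-𝒟 n d) d∈) p∈L))

theorem28 : (n : ℕ) → n ≥ 1 →
    pf n ((3 ∷ 1 ∷ 2 ∷ []) ∷ (3 ∷ 2 ∷ 1 ∷ []) ∷ [])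
    ≡ sum (map (λ d → product (map (_+ 1) (take (length (w d) ∸ 1) (w d)))) (𝒟 n))
theorem28 n _ = begin
  length (avoidingPFs n ([312] ∷ [321] ∷ []))
    -- Both lists are repetition-free and have the same elements, so each is a rearrangement of the
    -- other.
    ≡⟨ ↭-length (∼bag⇒↭ (unique∧set⇒bag
         (avoidingPFs-unique n ([312] ∷ [321] ∷ []))
         (concatMap-unique path labellings-path (labellings-unique ≤-refl) (𝒟-unique n))
         (∈-avoidingPFs⇔∈-labellings n))) ⟩
  length (concatMap (labellings 1 2) (𝒟 n))
    ≡⟨ length-concatMap (labellings 1 2) (𝒟 n) ⟩
  sum (map (length ∘ labellings 1 2) (𝒟 n))
    ≡⟨ cong sum (map-cong weight-labellings (𝒟 n)) ⟨
  sum (map (weight ∘ w) (𝒟 n)) ∎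
  where open ≡-Reasoning
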